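{- Let $D\in\{0,1,2\}^{p\times m}$ be a matrix such that the sum of the entries of each column equals $2$, and let $\mathcal{L}_D=\{v\in\mathbb{Z}^m: Dv=0\}$. Let $\lambda(\mathcal{L}_D)$ be the minimum of $|v|$ over nonzero $v\in\mathcal{L}_D$. Then $|\{v\in\mathcal{L}_D: |v|<2\lambda(\mathcal{L}_D)\}|\le m^{O(1)}$.
   Context: For $v\in\mathbb{R}^m$, $|v|=\sum_{i=1}^m|v_i|$ denotes the $L_1$ norm. The bound $m^{O(1)}$ means at most $m^c$ for an absolute constant $c$ independent of $D$, $p$, $m$. -}

module Defs where

open import Data.Nat using (ℕ; zero; suc; _≤_)
import Data.Nat as N
open import Data.Integer using (ℤ; +_; ∣_∣)
import Data.Integer as Z
open import Data.Fin using (Fin; toℕ)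
import Data.Fin as F
open import Data.Vec using (Vec; lookup; replicate)
open import Data.Product using (∃; _×_)
open import Relation.Binary.PropositionalEquality using (_≡_; _≢_)

-- Σ_{i<n} f i over ℕ and over ℤ
sumℕ : ∀ {n} → (Fin n → ℕ) → ℕ
sumℕ {zero}  f = 0
sumℕ {suc n} f = f F.zero N.+ sumℕ (λ i → f (F.suc i))

sumℤ : ∀ {n} → (Fin n → ℤ) → ℤ
sumℤ {zero}  f = + 0
sumℤ {suc n} f = f F.zero Z.+ sumℤ (λ i → f (F.suc i))

-- A p×m matrix with entries in {0,1,2} (Fin 3, read via toℕ)
Matrix012 : ℕ → ℕ → Set
Matrix012 p m = Fin p → Fin m → Fin 3

-- every column sums to 2
ColumnSumsTwo : ∀ {p m} → Matrix012 p m → Set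
ColumnSumsTwo {p} {m} D = ∀ (j : Fin m) → sumℕ (λ (i : Fin p) → toℕ (D i j)) ≡ 2

-- v ∈ L_D  iff  D v = 0
InLattice : ∀ {p m} → Matrix012 p m → Vec ℤ m → Set
InLattice {p} {m} D v =
  ∀ (i : Fin p) → sumℤ (λ (j : Fin m) → (+ toℕ (D i j)) Z.* lookup v j) ≡ + 0

-- L1 norm
norm1 : ∀ {m} → Vec ℤ m → ℕ
norm1 {m} v = sumℕ (λ (j : Fin m) → ∣ lookup v j ∣)

-- lam = λ(L_D) = min { |v| : v ∈ L_D, v ≠ 0 }  (attained)
IsMinNorm : ∀ {p m} → Matrix012 p m → ℕ → Set
IsMinNorm {p} {m} D lam =
  (∃ λ (v : Vec ℤ m) → InLattice D v × v ≢ replicate m (+ 0) × norm1 v ≡ lam)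
  × (∀ (v : Vec ℤ m) → InLattice D v → v ≢ replicate m (+ 0) → lam ≤ norm1 v)

-- Read D as the incidence matrix of a multigraph: rows are vertices, columns are edges (a 2 is a
-- loop). A lattice vector v ≠ 0 with |v| < 2λ peels off, one signed unit vector at a time, into an
-- alternating walk: after each step the partial sum y satisfies D y = ±e(start) ± e(current), and the
-- next step uses an edge at the current vertex on which v − y has the opposite sign. Such an edge
-- always exists, for otherwise the walk has closed up, D y = 0, and y, v − y would be nonzero lattice
-- vectors with |y| + |v − y| = |v| < 2λ. Pick s with 2s < λ ≤ 2s + 2 and cut the |v| ≤ 4(s + 1) steps
-- into at most four runs of at most s + 1 steps. Record the first step of the walk and the last step
-- of every run: these determine D at each cut point, and the rest of a run has norm ≤ s, so since two
-- vectors with equal images at distance < λ coincide, the runs and hence v are determined. Thus v is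
-- encoded by at most 5 of the 4m possible steps, leaving at most (4m + 1)⁵ ≤ m²⁰ short vectors.
module Submission where

open import Defs
open import Data.Nat using (ℕ; _≤_; _<_; _*_; _^_)
open import Data.Integer using (ℤ)
open import Data.Vec using (Vec)
open import Data.List using (List; length)
open import Data.List.Relation.Unary.All using (All)
open import Data.List.Relation.Unary.Unique.Propositional using (Unique)
open import Data.Product using (∃; _×_)

import Algebra.Properties.CommutativeMonoid.Sum as CommutativeMonoidSum
import Algebra.Properties.Semiring.Sum as SemiringSum
open import Data.Bool.Base using (if_then_else_)
open import Data.Fin.Base using (Fin; zero; suc; toℕ; combine; funToFin; finToFun)
open import Data.Fin.Patterns using (0F; 1F)
open import Data.Fin.Properties using (_≟_; all?; any?)
import Data.Fin.Properties as Finₚ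
open import Data.Integer.Base as ℤ using (+_; 0ℤ; 1ℤ; ∣_∣; _◃_)
import Data.Integer.Properties as ℤₚ
open import Data.Integer.Tactic.RingSolver using (solve-∀)
open import Data.List.Base using ([]; _∷_; drop; map)
import Data.List.Base as List
import Data.List.Properties as Listₚ
open import Data.List.Membership.Propositional.Properties using (∈-lookup)
import Data.List.Relation.Unary.All as All
open import Data.List.Relation.Unary.All using (_∷_)
open import Data.List.Relation.Unary.AllPairs using (_∷_)
open import Data.Nat.Base using (zero; suc; _+_; z≤n; s≤s; ⌊_/2⌋; ⌈_/2⌉)
import Data.Nat.Properties as ℕₚ
open import Data.Nat.Tactic.RingSolver using () renaming (solve-∀ to ℕ-solve-∀)
open import Data.Product.Base using (Σ; ∃₂; _,_; proj₁; proj₂)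
open import Data.Sign.Base as Sign using (Sign; opposite)
open import Data.Sum.Base using (inj₁; inj₂)
import Data.Vec.Base as Vec
open import Data.Vec.Base using (lookup; tabulate; replicate)
import Data.Vec.Properties as Vecₚ
open import Function.Base using (_∘_)
open import Relation.Binary.PropositionalEquality
  using (_≡_; _≢_; _≗_; refl; sym; trans; cong; cong₂; subst; module ≡-Reasoning)
open import Relation.Nullary.Decidable using (does; yes; no; ¬?; _×-dec_)
open import Relation.Nullary.Negation using (¬_; contradiction)

private
  module ℕ∑ = CommutativeMonoidSum ℕₚ.+-0-commutativeMonoid
  module ℤ∑ = SemiringSum ℤₚ.+-*-semiring

-- Finite sums

sumℕ≡∑ : ∀ {n} (f : Fin n → ℕ) → sumℕ f ≡ ℕ∑.sum f
sumℕ≡∑ {zero}  f = refl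
sumℕ≡∑ {suc n} f = cong (λ s → f zero + s) (sumℕ≡∑ (f ∘ suc))

sumℤ≡∑ : ∀ {n} (f : Fin n → ℤ) → sumℤ f ≡ ℤ∑.sum f
sumℤ≡∑ {zero}  f = refl
sumℤ≡∑ {suc n} f = cong (λ s → f zero ℤ.+ s) (sumℤ≡∑ (f ∘ suc))

sumℕ-cong : ∀ {n} {f g : Fin n → ℕ} → f ≗ g → sumℕ f ≡ sumℕ g
sumℕ-cong {f = f} {g} f≗g rewrite sumℕ≡∑ f | sumℕ≡∑ g = ℕ∑.sum-cong-≗ f≗g

sumℕ-+ : ∀ {n} (f g : Fin n → ℕ) → sumℕ (λ k → f k + g k) ≡ sumℕ f + sumℕ g
sumℕ-+ f g rewrite sumℕ≡∑ f | sumℕ≡∑ g | sumℕ≡∑ (λ k → f k + g k) = ℕ∑.∑-distrib-+ f g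

sumℕ-zero : ∀ {n} {f : Fin n → ℕ} → (∀ k → f k ≡ 0) → sumℕ f ≡ 0
sumℕ-zero {zero}  f≗0 = refl
sumℕ-zero {suc n} f≗0 = cong₂ _+_ (f≗0 zero) (sumℕ-zero (f≗0 ∘ suc))

sumℕ-mono : ∀ {n} {f g : Fin n → ℕ} → (∀ k → f k ≤ g k) → sumℕ f ≤ sumℕ g
sumℕ-mono {zero}  f≤g = z≤n
sumℕ-mono {suc n} f≤g = ℕₚ.+-mono-≤ (f≤g zero) (sumℕ-mono (f≤g ∘ suc))

sumℕ≡0⇒≡0 : ∀ {n} (f : Fin n → ℕ) → sumℕ f ≡ 0 → ∀ k → f k ≡ 0
sumℕ≡0⇒≡0 f sum≡0 zero    = ℕₚ.m+n≡0⇒m≡0 (f zero) sum≡0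
sumℕ≡0⇒≡0 f sum≡0 (suc k) = sumℕ≡0⇒≡0 (f ∘ suc) (ℕₚ.m+n≡0⇒n≡0 (f zero) sum≡0) k

sumℕ-update : ∀ {n} {f g : Fin n → ℕ} (j : Fin n) {d} →
              (∀ k → j ≢ k → f k ≡ g k) → f j + d ≡ g j → sumℕ f + d ≡ sumℕ g
sumℕ-update {f = f} {g} zero {d} same fj+d≡gj = begin
  (f zero + sumℕ (f ∘ suc)) + d  ≡⟨ ℕₚ.+-assoc (f zero) _ d ⟩
  f zero + (sumℕ (f ∘ suc) + d)  ≡⟨ cong (λ s → f zero + s) (ℕₚ.+-comm _ d) ⟩
  f zero + (d + sumℕ (f ∘ suc))  ≡⟨ ℕₚ.+-assoc (f zero) d _ ⟨
  (f zero + d) + sumℕ (f ∘ suc)  ≡⟨ cong₂ _+_ fj+d≡gj (sumℕ-cong (λ k → same (suc k) (λ ()))) ⟩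
  g zero + sumℕ (g ∘ suc)        ∎
  where open ≡-Reasoning
sumℕ-update {f = f} {g} (suc j) {d} same fj+d≡gj = begin
  (f zero + sumℕ (f ∘ suc)) + d  ≡⟨ ℕₚ.+-assoc (f zero) _ d ⟩
  f zero + (sumℕ (f ∘ suc) + d)  ≡⟨ cong₂ _+_ (same zero (λ ())) (sumℕ-update j same′ fj+d≡gj) ⟩
  g zero + sumℕ (g ∘ suc)        ∎
  where
  open ≡-Reasoning
  same′ : ∀ k → j ≢ k → f (suc k) ≡ g (suc k)
  same′ k j≢k = same (suc k) (j≢k ∘ Finₚ.suc-injective)

sumℤ-cong : ∀ {n} {f g : Fin n → ℤ} → f ≗ g → sumℤ f ≡ sumℤ g
sumℤ-cong {f = f} {g} f≗g rewrite sumℤ≡∑ f | sumℤ≡∑ g = ℤ∑.sum-cong-≗ f≗g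

sumℤ-+ : ∀ {n} (f g : Fin n → ℤ) → sumℤ (λ k → f k ℤ.+ g k) ≡ sumℤ f ℤ.+ sumℤ g
sumℤ-+ f g rewrite sumℤ≡∑ f | sumℤ≡∑ g | sumℤ≡∑ (λ k → f k ℤ.+ g k) = ℤ∑.∑-distrib-+ f g

sumℤ-*ˡ : ∀ {n} a (f : Fin n → ℤ) → sumℤ (λ k → a ℤ.* f k) ≡ a ℤ.* sumℤ f
sumℤ-*ˡ a f rewrite sumℤ≡∑ f | sumℤ≡∑ (λ k → a ℤ.* f k) = sym (ℤ∑.*-distribˡ-sum a f)

sumℤ-zero : ∀ {n} {f : Fin n → ℤ} → (∀ k → f k ≡ 0ℤ) → sumℤ f ≡ 0ℤ
sumℤ-zero {zero}  f≗0 = refl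
sumℤ-zero {suc n} f≗0 = cong₂ ℤ._+_ (f≗0 zero) (sumℤ-zero (f≗0 ∘ suc))

sumℤ-single : ∀ {n} {f : Fin n → ℤ} (j : Fin n) → (∀ k → j ≢ k → f k ≡ 0ℤ) → sumℤ f ≡ f j
sumℤ-single {f = f} zero off = begin
  f zero ℤ.+ sumℤ (f ∘ suc)  ≡⟨ cong (λ s → f zero ℤ.+ s) (sumℤ-zero (λ k → off (suc k) (λ ()))) ⟩
  f zero ℤ.+ 0ℤ              ≡⟨ ℤₚ.+-identityʳ (f zero) ⟩
  f zero                     ∎
  where open ≡-Reasoning
sumℤ-single {f = f} (suc j) off = begin
  f zero ℤ.+ sumℤ (f ∘ suc)  ≡⟨ cong₂ ℤ._+_ (off zero (λ ())) (sumℤ-single j off′) ⟩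
  0ℤ ℤ.+ f (suc j)           ≡⟨ ℤₚ.+-identityˡ (f (suc j)) ⟩
  f (suc j)                  ∎
  where
  open ≡-Reasoning
  off′ : ∀ k → j ≢ k → f (suc k) ≡ 0ℤ
  off′ k j≢k = off (suc k) (j≢k ∘ Finₚ.suc-injective)

sumℤ-nonpositive : ∀ {n} {f : Fin n → ℤ} → (∀ k → f k ℤ.≤ 0ℤ) → sumℤ f ℤ.≤ 0ℤ
sumℤ-nonpositive {zero}  f≤0 = ℤₚ.≤-refl
sumℤ-nonpositive {suc n} f≤0 = ℤₚ.+-mono-≤ (f≤0 zero) (sumℤ-nonpositive (f≤0 ∘ suc))

-- Unit vectors and the ℓ¹ norm

unit : ∀ {n} → Fin n → ℤ → Fin n → ℤ
unit j z k = if does (j ≟ k) then z else 0ℤ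

unit-≡ : ∀ {n} (j : Fin n) z → unit j z j ≡ z
unit-≡ j z with j ≟ j
... | yes _   = refl
... | no j≢j = contradiction refl j≢j

unit-≢ : ∀ {n} {j k : Fin n} z → j ≢ k → unit j z k ≡ 0ℤ
unit-≢ {j = j} {k} z j≢k with j ≟ k
... | yes j≡k = contradiction j≡k j≢k
... | no _    = refl

unit-scale : ∀ {n} (j k : Fin n) z → unit j 1ℤ k ℤ.* z ≡ unit j z k
unit-scale j k z with j ≟ k
... | yes _ = ℤₚ.*-identityˡ z
... | no _  = refl

unit-cancel : ∀ {n} (j k : Fin n) s → unit j (s ◃ 1) k ℤ.+ unit j (opposite s ◃ 1) k ≡ 0ℤ
unit-cancel j k s with j ≟ k
unit-cancel j k Sign.+ | yes _ = refl
unit-cancel j k Sign.- | yes _ = refl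
unit-cancel j k s      | no _  = refl

1+unit≢0 : ∀ {n} (j k : Fin n) → 1ℤ ℤ.+ unit j 1ℤ k ≢ 0ℤ
1+unit≢0 j k with j ≟ k
... | yes _ = λ ()
... | no _  = λ ()

sumℕ≡1⇒unit : ∀ {n} (f : Fin n → ℕ) → sumℕ f ≡ 1 → ∃ λ x → ∀ k → + f k ≡ unit x 1ℤ k
sumℕ≡1⇒unit {suc n} f sum≡1 with f zero in f₀≡
... | zero with sumℕ≡1⇒unit (f ∘ suc) sum≡1
...   | x , f≗ = suc x , λ { zero → cong +_ f₀≡ ; (suc k) → f≗ k }
sumℕ≡1⇒unit {suc n} f sum≡1 | suc zero = zero , λ
  { zero    → cong +_ f₀≡
  ; (suc k) → cong +_ (sumℕ≡0⇒≡0 (f ∘ suc) (ℕₚ.suc-injective sum≡1) k)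
  }

sumℕ≡2⇒unit+unit : ∀ {n} (f : Fin n → ℕ) → sumℕ f ≡ 2 →
                   ∃₂ λ x y → ∀ k → + f k ≡ unit x 1ℤ k ℤ.+ unit y 1ℤ k
sumℕ≡2⇒unit+unit {suc n} f sum≡2 with f zero in f₀≡
... | zero with sumℕ≡2⇒unit+unit (f ∘ suc) sum≡2
...   | x , y , f≗ = suc x , suc y , λ { zero → cong +_ f₀≡ ; (suc k) → f≗ k }
sumℕ≡2⇒unit+unit {suc n} f sum≡2 | suc zero with sumℕ≡1⇒unit (f ∘ suc) (ℕₚ.suc-injective sum≡2)
... | y , f≗ = zero , suc y , λ
  { zero    → cong +_ f₀≡
  ; (suc k) → trans (f≗ k) (sym (ℤₚ.+-identityˡ _))
  }
sumℕ≡2⇒unit+unit {suc n} f sum≡2 | suc (suc zero) = zero , zero , λ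
  { zero    → cong +_ f₀≡
  ; (suc k) → cong +_ (sumℕ≡0⇒≡0 (f ∘ suc) (ℕₚ.suc-injective (ℕₚ.suc-injective sum≡2)) k)
  }

infixl 6 _⊕_ _⊖_

_⊕_ : ∀ {n} → (Fin n → ℤ) → (Fin n → ℤ) → Fin n → ℤ
(x ⊕ y) k = x k ℤ.+ y k

_⊖_ : ∀ {n} → (Fin n → ℤ) → (Fin n → ℤ) → Fin n → ℤ
(x ⊖ y) k = x k ℤ.- y k

0⃗ : ∀ {n} → Fin n → ℤ
0⃗ _ = 0ℤ

∥_∥ : ∀ {n} → (Fin n → ℤ) → ℕ
∥ x ∥ = sumℕ (λ k → ∣ x k ∣)

sign-of : ∀ a → a ≢ 0ℤ → ∃ λ s → 0ℤ ℤ.< (s ◃ 1) ℤ.* a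
sign-of (+ zero)   a≢0 = contradiction refl a≢0
sign-of (+ suc n)  _   = Sign.+ , ℤ.+<+ (s≤s z≤n)
sign-of ℤ.-[1+ n ] _   = Sign.- , ℤ.+<+ (s≤s z≤n)

∣a-s∣+1≡∣a∣ : ∀ s a → 0ℤ ℤ.< (s ◃ 1) ℤ.* a → ∣ a ℤ.- (s ◃ 1) ∣ + 1 ≡ ∣ a ∣
∣a-s∣+1≡∣a∣ Sign.+ (+ suc n)         _ = ℕₚ.+-comm n 1
∣a-s∣+1≡∣a∣ Sign.- ℤ.-[1+ zero ]    _ = refl
∣a-s∣+1≡∣a∣ Sign.- ℤ.-[1+ suc n ]   _ = ℕₚ.+-comm (suc n) 1
∣a-s∣+1≡∣a∣ Sign.+ (+ zero)  (ℤ.+<+ ())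
∣a-s∣+1≡∣a∣ Sign.- (+ zero)  (ℤ.+<+ ())

signed-term-nonpositive : ∀ d s x → (d ≢ 0 → s ℤ.* x ℤ.≤ 0ℤ) → s ℤ.* (+ d ℤ.* x) ℤ.≤ 0ℤ
signed-term-nonpositive zero    s x _    = ℤₚ.≤-reflexive (ℤₚ.*-zeroʳ s)
signed-term-nonpositive (suc d) s x sx≤0 = begin
  s ℤ.* (+ suc d ℤ.* x)  ≡⟨ swap s (+ suc d) x ⟩
  + suc d ℤ.* (s ℤ.* x)  ≤⟨ ℤₚ.*-monoˡ-≤-nonNeg (+ suc d) (sx≤0 (λ ())) ⟩
  + suc d ℤ.* 0ℤ         ≡⟨ ℤₚ.*-zeroʳ (+ suc d) ⟩
  0ℤ                     ∎
  where
  open ℤₚ.≤-Reasoning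
  swap : ∀ a b c → a ℤ.* (b ℤ.* c) ≡ b ℤ.* (a ℤ.* c)
  swap = solve-∀

module _ {n : ℕ} where

  ∥∥-cong : {x y : Fin n → ℤ} → x ≗ y → ∥ x ∥ ≡ ∥ y ∥
  ∥∥-cong x≗y = sumℕ-cong (cong ∣_∣ ∘ x≗y)

  ∥∥-subadditive : {x y z : Fin n → ℤ} → (∀ k → ∣ x k ∣ ≤ ∣ y k ∣ + ∣ z k ∣) → ∥ x ∥ ≤ ∥ y ∥ + ∥ z ∥
  ∥∥-subadditive {y = y} {z} ≤y+z =
    ℕₚ.≤-trans (sumℕ-mono ≤y+z) (ℕₚ.≤-reflexive (sumℕ-+ (λ k → ∣ y k ∣) (λ k → ∣ z k ∣)))

  ∥x∥≡0⇒x≗0⃗ : {x : Fin n → ℤ} → ∥ x ∥ ≡ 0 → x ≗ 0⃗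
  ∥x∥≡0⇒x≗0⃗ {x} ∥x∥≡0 = ℤₚ.∣i∣≡0⇒i≡0 ∘ sumℕ≡0⇒≡0 (λ k → ∣ x k ∣) ∥x∥≡0

  x≗0⃗⇒∥x∥≡0 : {x : Fin n → ℤ} → x ≗ 0⃗ → ∥ x ∥ ≡ 0
  x≗0⃗⇒∥x∥≡0 x≗0 = sumℕ-zero (cong ∣_∣ ∘ x≗0)

  ∥unit∥ : ∀ (j : Fin n) s → ∥ unit j (s ◃ 1) ∥ ≡ 1
  ∥unit∥ j s = begin
    ∥ unit j (s ◃ 1) ∥        ≡⟨ sumℕ-update j off at-j ⟨
    sumℕ {n} (λ _ → 0) + 1    ≡⟨ cong (_+ 1) (sumℕ-zero {n} (λ _ → refl)) ⟩
    1                         ∎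
    where
    open ≡-Reasoning
    off : ∀ k → j ≢ k → 0 ≡ ∣ unit j (s ◃ 1) k ∣
    off k j≢k = sym (cong ∣_∣ (unit-≢ (s ◃ 1) j≢k))
    at-j : 1 ≡ ∣ unit j (s ◃ 1) j ∣
    at-j = sym (trans (cong ∣_∣ (unit-≡ j (s ◃ 1))) (ℤₚ.abs-◃ s 1))

  ∥x⊖unit∥ : ∀ (x : Fin n → ℤ) j s → 0ℤ ℤ.< (s ◃ 1) ℤ.* x j → suc ∥ x ⊖ unit j (s ◃ 1) ∥ ≡ ∥ x ∥
  ∥x⊖unit∥ x j s positive = trans (ℕₚ.+-comm 1 _) (sumℕ-update j off at-j)
    where
    off : ∀ k → j ≢ k → ∣ x k ℤ.- unit j (s ◃ 1) k ∣ ≡ ∣ x k ∣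
    off k j≢k = cong ∣_∣ (trans (cong (λ z → x k ℤ.- z) (unit-≢ (s ◃ 1) j≢k)) (ℤₚ.+-identityʳ (x k)))
    at-j : ∣ x j ℤ.- unit j (s ◃ 1) j ∣ + 1 ≡ ∣ x j ∣
    at-j rewrite unit-≡ j (s ◃ 1) = ∣a-s∣+1≡∣a∣ s (x j) positive

-- Counting

Unique-lookup-injective : ∀ {A : Set} {xs : List A} → Unique xs →
                          ∀ {i j} → List.lookup xs i ≡ List.lookup xs j → i ≡ j
Unique-lookup-injective (_  ∷ _) {zero}  {zero}  _  = refl
Unique-lookup-injective (x∉ ∷ _) {zero}  {suc j} eq = contradiction eq (All.lookup x∉ (∈-lookup j))
Unique-lookup-injective (x∉ ∷ _) {suc i} {zero}  eq = contradiction (sym eq) (All.lookup x∉ (∈-lookup i))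
Unique-lookup-injective (_  ∷ u) {suc i} {suc j} eq = cong suc (Unique-lookup-injective u eq)

Unique⇒length≤ : ∀ {A : Set} {P : A → Set} {n} {xs : List A} → Unique xs → All P xs →
                 (f : ∀ {x} → P x → Fin n) → (∀ {x y} (px : P x) (py : P y) → f px ≡ f py → x ≡ y) →
                 length xs ≤ n
Unique⇒length≤ unique all f f-injective =
  Finₚ.injective⇒≤ λ {i} {j} eq → Unique-lookup-injective unique (f-injective (witness i) (witness j) eq)
  where
  witness = λ i → All.lookup all (∈-lookup i)

pad : ∀ {k n} → List (Fin k) → Fin n → Fin (suc k)
pad []       _       = zero
pad (x ∷ xs) zero    = suc x
pad (x ∷ xs) (suc i) = pad xs i

pad-injective : ∀ {k n} {xs ys : List (Fin k)} → length xs ≤ n → length ys ≤ n →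
                pad {n = n} xs ≗ pad ys → xs ≡ ys
pad-injective {xs = []}    {[]}    _       _        _  = refl
pad-injective {xs = []}    {_ ∷ _} _       (s≤s _)  eq = contradiction (eq zero) Finₚ.0≢1+n
pad-injective {xs = _ ∷ _} {[]}    (s≤s _) _        eq = contradiction (sym (eq zero)) Finₚ.0≢1+n
pad-injective {xs = _ ∷ _} {_ ∷ _} (s≤s l) (s≤s l′) eq =
  cong₂ _∷_ (Finₚ.suc-injective (eq zero)) (pad-injective l l′ (eq ∘ suc))

encodeList : ∀ {k n} → List (Fin k) → Fin (suc k ^ n)
encodeList {n = n} xs = funToFin (pad {n = n} xs)

encodeList-injective : ∀ {k n} {xs ys : List (Fin k)} → length xs ≤ n → length ys ≤ n →
                       encodeList {n = n} xs ≡ encodeList {n = n} ys → xs ≡ ys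
encodeList-injective {n = n} {xs} {ys} l l′ eq = pad-injective l l′ λ i → begin
  pad xs i                            ≡⟨ Finₚ.finToFun-funToFin (pad xs) i ⟨
  finToFun (encodeList {n = n} xs) i  ≡⟨ cong (λ c → finToFun c i) eq ⟩
  finToFun (encodeList {n = n} ys) i  ≡⟨ Finₚ.finToFun-funToFin (pad ys) i ⟩
  pad ys i                            ∎
  where open ≡-Reasoning

lookup-injective : ∀ {A : Set} {n} {v w : Vec A n} → lookup v ≗ lookup w → v ≡ w
lookup-injective {v = v} {w} eq = begin
  v                    ≡⟨ Vecₚ.tabulate∘lookup v ⟨
  tabulate (lookup v)  ≡⟨ Vecₚ.tabulate-cong eq ⟩
  tabulate (lookup w)  ≡⟨ Vecₚ.tabulate∘lookup w ⟩
  w                    ∎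
  where open ≡-Reasoning

halve : ∀ l → ∃ λ s → s + s ≤ l × l ≤ s + suc s
halve l = ⌊ l /2⌋ , lower , upper
  where
  open ℕₚ.≤-Reasoning
  lower : ⌊ l /2⌋ + ⌊ l /2⌋ ≤ l
  lower = begin
    ⌊ l /2⌋ + ⌊ l /2⌋  ≤⟨ ℕₚ.+-monoʳ-≤ ⌊ l /2⌋ (ℕₚ.⌊n/2⌋≤⌈n/2⌉ l) ⟩
    ⌊ l /2⌋ + ⌈ l /2⌉  ≡⟨ ℕₚ.⌊n/2⌋+⌈n/2⌉≡n l ⟩
    l                  ∎
  upper : l ≤ ⌊ l /2⌋ + suc ⌊ l /2⌋
  upper = begin
    l                      ≡⟨ ℕₚ.⌊n/2⌋+⌈n/2⌉≡n l ⟨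
    ⌊ l /2⌋ + ⌈ l /2⌉      ≤⟨ ℕₚ.+-monoʳ-≤ ⌊ l /2⌋ (ℕₚ.⌊n/2⌋-mono (ℕₚ.n≤1+n (suc l))) ⟩
    ⌊ l /2⌋ + suc ⌊ l /2⌋  ∎

power-bound : ∀ {m} → 2 ≤ m → suc (m * 4) ^ 5 ≤ m ^ 20
power-bound {m} 2≤m = begin
  suc (m * 4) ^ 5  ≤⟨ ℕₚ.^-monoˡ-≤ 5 (begin
                        suc (m * 4)  ≤⟨ ℕₚ.+-monoˡ-≤ (m * 4) (ℕₚ.≤-trans (s≤s z≤n) 2≤m) ⟩
                        m + m * 4    ≡⟨ ℕₚ.*-suc m 4 ⟨
                        m * 5        ≤⟨ ℕₚ.*-monoʳ-≤ m (ℕₚ.≤-trans (ℕₚ.m≤m+n 5 3) (ℕₚ.^-monoˡ-≤ 3 2≤m)) ⟩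
                        m ^ 4        ∎) ⟩
  (m ^ 4) ^ 5      ≡⟨ ℕₚ.^-*-assoc m 4 5 ⟩
  m ^ 20           ∎
  where open ℕₚ.≤-Reasoning

-- Alternating walks

-- A step (j , s , b) adds s eⱼ and arrives at endpoint b of edge j.
Step : ℕ → Set
Step m = Fin m × Sign × Fin 2

module _ {m : ℕ} where

  edge : Step m → Fin m
  edge (j , _ , _) = j

  sign : Step m → Sign
  sign (_ , s , _) = s

  stepVec : Step m → Fin m → ℤ
  stepVec (j , s , _) = unit j (s ◃ 1)

signIndex : Sign → Fin 2
signIndex Sign.- = 0F
signIndex Sign.+ = 1F

signIndex-injective : ∀ {s t} → signIndex s ≡ signIndex t → s ≡ t
signIndex-injective {Sign.-} {Sign.-} _ = refl
signIndex-injective {Sign.+} {Sign.+} _ = refl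

stepIndex : ∀ {m} → Step m → Fin (m * 4)
stepIndex (j , s , b) = combine j (combine (signIndex s) b)

stepIndex-injective : ∀ {m} {u u′ : Step m} → stepIndex u ≡ stepIndex u′ → u ≡ u′
stepIndex-injective {u = j , s , b} {j′ , s′ , b′} eq with Finₚ.combine-injective j _ j′ _ eq
... | refl , eq′ with Finₚ.combine-injective (signIndex s) b (signIndex s′) b′ eq′
...   | s≡s′ , refl rewrite signIndex-injective s≡s′ = refl

closes-at-start : ∀ s₀ σ → (opposite σ ◃ 1) ℤ.* (0ℤ ℤ.- ((s₀ ◃ 1) ℤ.+ (σ ◃ 1))) ℤ.≤ 0ℤ → s₀ ≡ opposite σ
closes-at-start Sign.+ Sign.- _ = refl
closes-at-start Sign.- Sign.+ _ = refl
closes-at-start Sign.+ Sign.+ (ℤ.+≤+ ())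
closes-at-start Sign.- Sign.- (ℤ.+≤+ ())

cannot-close-elsewhere : ∀ σ → ¬ (opposite σ ◃ 1) ℤ.* (0ℤ ℤ.- (0ℤ ℤ.+ (σ ◃ 1))) ℤ.≤ 0ℤ
cannot-close-elsewhere Sign.+ (ℤ.+≤+ ())
cannot-close-elsewhere Sign.- (ℤ.+≤+ ())

module Lattice {p m : ℕ} (D : Matrix012 p m) (columns : ColumnSumsTwo D) where

  image : (Fin m → ℤ) → Fin p → ℤ
  image x i = sumℤ (λ j → + toℕ (D i j) ℤ.* x j)

  image-cong : ∀ {x y} → x ≗ y → image x ≗ image y
  image-cong x≗y i = sumℤ-cong (λ j → cong (λ z → + toℕ (D i j) ℤ.* z) (x≗y j))

  image-⊕ : ∀ x y → image (x ⊕ y) ≗ image x ⊕ image y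
  image-⊕ x y i = trans (sumℤ-cong (λ j → ℤₚ.*-distribˡ-+ (+ toℕ (D i j)) (x j) (y j)))
                        (sumℤ-+ (λ j → + toℕ (D i j) ℤ.* x j) (λ j → + toℕ (D i j) ℤ.* y j))

  image-⊖ : ∀ x y → image (x ⊖ y) ≗ image x ⊖ image y
  image-⊖ x y i = begin
    image (x ⊖ y) i                            ≡⟨ sumℤ-cong (λ j → split (+ toℕ (D i j)) (x j) (y j)) ⟩
    sumℤ (λ j → Dx j ℤ.+ ℤ.-1ℤ ℤ.* Dy j)       ≡⟨ sumℤ-+ Dx (λ j → ℤ.-1ℤ ℤ.* Dy j) ⟩
    image x i ℤ.+ sumℤ (λ j → ℤ.-1ℤ ℤ.* Dy j)  ≡⟨ cong (λ z → image x i ℤ.+ z) (sumℤ-*ˡ ℤ.-1ℤ Dy) ⟩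
    image x i ℤ.+ ℤ.-1ℤ ℤ.* image y i          ≡⟨ cong (λ z → image x i ℤ.+ z) (ℤₚ.-1*i≡-i (image y i)) ⟩
    image x i ℤ.- image y i                    ∎
    where
    open ≡-Reasoning
    Dx Dy : Fin m → ℤ
    Dx j = + toℕ (D i j) ℤ.* x j
    Dy j = + toℕ (D i j) ℤ.* y j
    split : ∀ d a b → d ℤ.* (a ℤ.- b) ≡ d ℤ.* a ℤ.+ ℤ.-1ℤ ℤ.* (d ℤ.* b)
    split = solve-∀

  image-unit : ∀ j z i → image (unit j z) i ≡ + toℕ (D i j) ℤ.* z
  image-unit j z i = trans (sumℤ-single j off) (cong (λ t → + toℕ (D i j) ℤ.* t) (unit-≡ j z))
    where
    off : ∀ k → j ≢ k → + toℕ (D i k) ℤ.* unit j z k ≡ 0ℤ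
    off k j≢k = trans (cong (λ t → + toℕ (D i k) ℤ.* t) (unit-≢ z j≢k)) (ℤₚ.*-zeroʳ (+ toℕ (D i k)))

  ColumnEnds : Fin m → Fin p → Fin p → Set
  ColumnEnds j x y = ∀ i → + toℕ (D i j) ≡ unit x 1ℤ i ℤ.+ unit y 1ℤ i

  column : ∀ j → ∃₂ λ x y → ColumnEnds j x y
  column j = sumℕ≡2⇒unit+unit (λ i → toℕ (D i j)) (columns j)

  ends : Fin m → Fin 2 → Fin p
  ends j 0F = proj₁ (column j)
  ends j 1F = proj₁ (proj₂ (column j))

  column-ends : ∀ j → ColumnEnds j (ends j 0F) (ends j 1F)
  column-ends j = proj₂ (proj₂ (column j))

  end-incident : ∀ j → toℕ (D (ends j 0F) j) ≢ 0
  end-incident j D≡0 = 1+unit≢0 y x (begin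
    1ℤ ℤ.+ unit y 1ℤ x           ≡⟨ cong (ℤ._+ unit y 1ℤ x) (unit-≡ x 1ℤ) ⟨
    unit x 1ℤ x ℤ.+ unit y 1ℤ x  ≡⟨ column-ends j x ⟨
    + toℕ (D x j)                ≡⟨ cong +_ D≡0 ⟩
    0ℤ                           ∎)
    where
    open ≡-Reasoning
    x = ends j 0F
    y = ends j 1F

  other-end : ∀ {a j} → toℕ (D a j) ≢ 0 → ∃ λ b → ColumnEnds j a (ends j b)
  other-end {a} {j} incident with ends j 0F ≟ a | ends j 1F ≟ a
  ... | yes refl | _        = 1F , column-ends j
  ... | no _     | yes refl =
    0F , λ i → trans (column-ends j i) (ℤₚ.+-comm (unit (ends j 0F) 1ℤ i) (unit a 1ℤ i))
  ... | no x≢a   | no y≢a   = contradiction (ℤₚ.+-injective not-incident) incident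
    where
    not-incident : + toℕ (D a j) ≡ 0ℤ
    not-incident = trans (column-ends j a) (cong₂ ℤ._+_ (unit-≢ 1ℤ x≢a) (unit-≢ 1ℤ y≢a))

  image-unit-column : ∀ {j x y} → ColumnEnds j x y → ∀ z → image (unit j z) ≗ unit x z ⊕ unit y z
  image-unit-column {j} {x} {y} col z i = begin
    image (unit j z) i                       ≡⟨ image-unit j z i ⟩
    + toℕ (D i j) ℤ.* z                      ≡⟨ cong (ℤ._* z) (col i) ⟩
    (unit x 1ℤ i ℤ.+ unit y 1ℤ i) ℤ.* z      ≡⟨ ℤₚ.*-distribʳ-+ z (unit x 1ℤ i) (unit y 1ℤ i) ⟩
    unit x 1ℤ i ℤ.* z ℤ.+ unit y 1ℤ i ℤ.* z  ≡⟨ cong₂ ℤ._+_ (unit-scale x i z) (unit-scale y i z) ⟩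
    unit x z i ℤ.+ unit y z i                ∎
    where open ≡-Reasoning

  image-unit≗0⃗⇒≡0 : ∀ j a → image (unit j a) ≗ 0⃗ → a ≡ 0ℤ
  image-unit≗0⃗⇒≡0 j a unit∈L
    with ℤₚ.i*j≡0⇒i≡0∨j≡0 (+ toℕ (D (ends j 0F) j))
                          (trans (sym (image-unit j a (ends j 0F))) (unit∈L (ends j 0F)))
  ... | inj₁ D≡0 = contradiction (ℤₚ.+-injective D≡0) (end-incident j)
  ... | inj₂ a≡0 = a≡0

  arrival : Step m → Fin p
  arrival (j , _ , b) = ends j b

  -- D maps the sum of the steps of an alternating walk whose first step is h (so that it leaves
  -- ends (edge h) 0F) and whose last step is u to boundary h u: all intermediate vertices cancel.
  boundary : Step m → Step m → Fin p → ℤ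
  boundary (j₀ , s₀ , _) (j , s , b) = unit (ends j₀ 0F) (s₀ ◃ 1) ⊕ unit (ends j b) (s ◃ 1)

  boundary-first : ∀ j s → image (stepVec (j , s , 1F)) ≗ boundary (j , s , 1F) (j , s , 1F)
  boundary-first j s = image-unit-column {x = ends j 0F} {ends j 1F} (column-ends j) (s ◃ 1)

  boundary-extend : ∀ {h u y j b} → ColumnEnds j (arrival u) (ends j b) → image y ≗ boundary h u →
                    image (y ⊕ stepVec (j , opposite (sign u) , b)) ≗ boundary h (j , opposite (sign u) , b)
  boundary-extend {h = j₀ , s₀ , _} {u = ju , σ , bu} {y} {j} {b} col img i = begin
    image (y ⊕ unit j (σ′ ◃ 1)) i
      ≡⟨ image-⊕ y (unit j (σ′ ◃ 1)) i ⟩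
    image y i ℤ.+ image (unit j (σ′ ◃ 1)) i
      ≡⟨ cong₂ ℤ._+_ (img i) (image-unit-column {x = a} {ends j b} col (σ′ ◃ 1) i) ⟩
    (start ℤ.+ unit a (σ ◃ 1) i) ℤ.+ (unit a (σ′ ◃ 1) i ℤ.+ next)
      ≡⟨ reassociate start (unit a (σ ◃ 1) i) _ next ⟩
    start ℤ.+ ((unit a (σ ◃ 1) i ℤ.+ unit a (σ′ ◃ 1) i) ℤ.+ next)
      ≡⟨ cong (λ t → start ℤ.+ (t ℤ.+ next)) (unit-cancel a i σ) ⟩
    start ℤ.+ (0ℤ ℤ.+ next)
      ≡⟨ cong (λ t → start ℤ.+ t) (ℤₚ.+-identityˡ next) ⟩
    start ℤ.+ next
      ∎
    where
    open ≡-Reasoning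
    σ′ = opposite σ
    a = ends ju bu
    start = unit (ends j₀ 0F) (s₀ ◃ 1) i
    next = unit (ends j b) (σ′ ◃ 1) i
    reassociate : ∀ w x y z → (w ℤ.+ x) ℤ.+ (y ℤ.+ z) ≡ w ℤ.+ ((x ℤ.+ y) ℤ.+ z)
    reassociate = solve-∀

  boundary-vanishes : ∀ (x a : Fin p) s₀ σ →
                      (opposite σ ◃ 1) ℤ.* (0ℤ ℤ.- (unit x (s₀ ◃ 1) a ℤ.+ (σ ◃ 1))) ℤ.≤ 0ℤ →
                      unit x (s₀ ◃ 1) ⊕ unit a (σ ◃ 1) ≗ 0⃗
  boundary-vanishes x a s₀ σ signed≤0 with x ≟ a
  ... | no _     = contradiction signed≤0 (cannot-close-elsewhere σ)
  ... | yes refl rewrite closes-at-start s₀ σ signed≤0 =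
    λ i → trans (ℤₚ.+-comm (unit a (opposite σ ◃ 1) i) (unit a (σ ◃ 1) i)) (unit-cancel a i σ)

  boundary-closes : ∀ h u → (opposite (sign u) ◃ 1) ℤ.* (0ℤ ℤ.- boundary h u (arrival u)) ℤ.≤ 0ℤ →
                    boundary h u ≗ 0⃗
  boundary-closes (j₀ , s₀ , _) (j , σ , b) signed≤0 =
    boundary-vanishes x (ends j b) s₀ σ
      (subst (λ t → (opposite σ ◃ 1) ℤ.* (0ℤ ℤ.- (unit x (s₀ ◃ 1) (ends j b) ℤ.+ t)) ℤ.≤ 0ℤ)
             (unit-≡ (ends j b) (σ ◃ 1)) signed≤0)
    where x = ends j₀ 0F

  data Walk (h : Step m) : (Fin m → ℤ) → (Fin m → ℤ) → List (Step m) → Set where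
    done : ∀ {a v} → a ≗ v → Walk h a v []
    step : ∀ {a v c cs} → image (a ⊕ stepVec c) ≗ boundary h c → Walk h (a ⊕ stepVec c) v cs →
           Walk h a v (c ∷ cs)

  -- A chunk is a run of consecutive steps remembered only through its last step c: the run leads
  -- from a to b, and all of it except that last step has norm at most s.
  data Chunks (s : ℕ) (h : Step m) : (Fin m → ℤ) → (Fin m → ℤ) → List (Step m) → Set where
    done  : ∀ {a v} → a ≗ v → Chunks s h a v []
    chunk : ∀ {a b v c cs} → ∥ b ⊖ a ⊖ stepVec c ∥ ≤ s → image b ≗ boundary h c → Chunks s h b v cs →
            Chunks s h a v (c ∷ cs)

  first-step-chunk : ∀ {h a v c us} → Walk h a v (c ∷ us) →
                     ∥ a ⊕ stepVec c ⊖ a ⊖ stepVec c ∥ ≤ 0 × image (a ⊕ stepVec c) ≗ boundary h c ×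
                     Walk h (a ⊕ stepVec c) v us
  first-step-chunk {a = a} {c = c} (step img w) =
    ℕₚ.≤-reflexive (x≗0⃗⇒∥x∥≡0 (λ k → cancel (a k) (stepVec c k))) , img , w
    where
    cancel : ∀ x e → x ℤ.+ e ℤ.- x ℤ.- e ≡ 0ℤ
    cancel = solve-∀

  merge-prefix : ∀ s {h a v c us} → Walk h a v (c ∷ us) →
                 Σ (Fin m → ℤ) λ b → Σ (Step m) λ c′ →
                   ∥ b ⊖ a ⊖ stepVec c′ ∥ ≤ s × image b ≗ boundary h c′ × Walk h b v (drop s us)
  merge-prefix zero {a = a} {c = c} w = a ⊕ stepVec c , c , first-step-chunk w
  merge-prefix (suc s) {a = a} {c = c} {us = []} w with first-step-chunk w
  ... | small , img , rest = a ⊕ stepVec c , c , ℕₚ.≤-trans small z≤n , img , rest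
  merge-prefix (suc s) {a = a} {c = c} {us = _ ∷ _} (step _ w) with merge-prefix s w
  ... | b , c′ , small , img , rest =
    b , c′ , ℕₚ.≤-trans (∥∥-subadditive {x = b ⊖ a ⊖ stepVec c′} {e} {b ⊖ (a ⊕ e) ⊖ stepVec c′} split) bound ,
    img , rest
    where
    e = stepVec c
    shift : ∀ x y e e′ → y ℤ.- x ℤ.- e′ ≡ e ℤ.+ (y ℤ.- (x ℤ.+ e) ℤ.- e′)
    shift = solve-∀
    split : ∀ k → ∣ (b ⊖ a ⊖ stepVec c′) k ∣ ≤ ∣ e k ∣ + ∣ (b ⊖ (a ⊕ e) ⊖ stepVec c′) k ∣
    split k rewrite shift (a k) (b k) (e k) (stepVec c′ k) =
      ℤₚ.∣i+j∣≤∣i∣+∣j∣ (e k) ((b ⊖ (a ⊕ e) ⊖ stepVec c′) k)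
    bound : ∥ e ∥ + ∥ b ⊖ (a ⊕ e) ⊖ stepVec c′ ∥ ≤ suc s
    bound = ℕₚ.+-mono-≤ (ℕₚ.≤-reflexive (∥unit∥ (edge c) (sign c))) small

  regroup : ∀ s r {h a v} us → length us ≤ r * suc s → Walk h a v us →
            Σ (List (Step m)) λ cs → Chunks s h a v cs × length cs ≤ r
  regroup s r       []       _   (done a≗v) = [] , done a≗v , z≤n
  regroup s zero    (c ∷ us) ()  w
  regroup s (suc r) (c ∷ us) len w with merge-prefix s w
  ... | b , c′ , small , img , rest with regroup s r (drop s us) remaining rest
    where
    remaining : length (drop s us) ≤ r * suc s
    remaining = subst (_≤ r * suc s) (sym (Listₚ.length-drop s us))
                      (ℕₚ.m≤n+o⇒m∸n≤o (length us) s (ℕₚ.≤-pred len))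
  ... | cs , chunks , len′ = c′ ∷ cs , chunk small img chunks , s≤s len′

  Encodes : ℕ → (Fin m → ℤ) → List (Step m) → Set
  Encodes s v []       = v ≗ 0⃗
  Encodes s v (h ∷ cs) = Chunks s h 0⃗ v cs

  module Minimal (lam : ℕ) (isMin : IsMinNorm D lam) where

    lam≤∥x∥ : ∀ {x} → image x ≗ 0⃗ → ¬ x ≗ 0⃗ → lam ≤ ∥ x ∥
    lam≤∥x∥ {x} x∈L x≢0 =
      subst (lam ≤_) (∥∥-cong (Vecₚ.lookup∘tabulate x)) (proj₂ isMin (tabulate x) tabulate-x∈L tabulate-x≢0)
      where
      tabulate-x∈L : InLattice D (tabulate x)
      tabulate-x∈L i = trans (image-cong (Vecₚ.lookup∘tabulate x) i) (x∈L i)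
      tabulate-x≢0 : tabulate x ≢ replicate m 0ℤ
      tabulate-x≢0 eq = x≢0 λ k → begin
        x k                        ≡⟨ Vecₚ.lookup∘tabulate x k ⟨
        lookup (tabulate x) k      ≡⟨ cong (λ v → lookup v k) eq ⟩
        lookup (replicate m 0ℤ) k  ≡⟨ Vecₚ.lookup-replicate k 0ℤ ⟩
        0ℤ                         ∎
        where open ≡-Reasoning

    separated : ∀ {x y} → image x ≗ image y → ∥ x ⊖ y ∥ < lam → x ≗ y
    separated {x} {y} same-image close with all? (λ k → (x ⊖ y) k ℤₚ.≟ 0ℤ)
    ... | yes x⊖y≗0 = λ k → ℤₚ.i-j≡0⇒i≡j (x k) (y k) (x⊖y≗0 k)
    ... | no x⊖y≢0  = contradiction close (ℕₚ.≤⇒≯ (lam≤∥x∥ x⊖y∈L x⊖y≢0))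
      where
      x⊖y∈L : image (x ⊖ y) ≗ 0⃗
      x⊖y∈L i = trans (image-⊖ x y i)
                      (trans (cong (λ t → image x i ℤ.- t) (sym (same-image i)))
                             (ℤₚ.+-inverseʳ (image x i)))

    module Walking {v : Fin m → ℤ} (v∈L : image v ≗ 0⃗) (short : ∥ v ∥ < 2 * lam) where

      record Trail (h : Step m) (y : Fin m → ℤ) (u : Step m) : Set where
        field
          image≗boundary : image y ≗ boundary h u
          ∥y∥+∥v⊖y∥≤∥v∥  : ∥ y ∥ + ∥ v ⊖ y ∥ ≤ ∥ v ∥
          ∥v⊖y∥<∥v∥      : ∥ v ⊖ y ∥ < ∥ v ∥
      open Trail

      take-step : ∀ {h y} u → ∥ y ∥ + ∥ v ⊖ y ∥ ≤ ∥ v ∥ → 0ℤ ℤ.< (sign u ◃ 1) ℤ.* (v ⊖ y) (edge u) →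
                  image (y ⊕ stepVec u) ≗ boundary h u →
                  suc ∥ v ⊖ (y ⊕ stepVec u) ∥ ≡ ∥ v ⊖ y ∥ × Trail h (y ⊕ stepVec u) u
      take-step {y = y} u@(j , s , _) tight positive img = shrink , record
        { image≗boundary = img
        ; ∥y∥+∥v⊖y∥≤∥v∥  = tight′
        ; ∥v⊖y∥<∥v∥      = ℕₚ.≤-trans (ℕₚ.≤-reflexive shrink) (ℕₚ.≤-trans (ℕₚ.m≤n+m _ ∥ y ∥) tight)
        }
        where
        y′ = y ⊕ stepVec u
        reassociate : ∀ a b e → a ℤ.- (b ℤ.+ e) ≡ a ℤ.- b ℤ.- e
        reassociate = solve-∀
        shrink : suc ∥ v ⊖ y′ ∥ ≡ ∥ v ⊖ y ∥
        shrink = trans (cong suc (∥∥-cong (λ k → reassociate (v k) (y k) (stepVec u k))))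
                       (∥x⊖unit∥ (v ⊖ y) j s positive)
        open ℕₚ.≤-Reasoning
        tight′ : ∥ y′ ∥ + ∥ v ⊖ y′ ∥ ≤ ∥ v ∥
        tight′ = begin
          ∥ y′ ∥ + ∥ v ⊖ y′ ∥                 ≤⟨ ℕₚ.+-monoˡ-≤ _ (∥∥-subadditive {x = y′} {y} {stepVec u}
                                                   (λ k → ℤₚ.∣i+j∣≤∣i∣+∣j∣ (y k) (stepVec u k))) ⟩
          (∥ y ∥ + ∥ stepVec u ∥) + ∥ v ⊖ y′ ∥  ≡⟨ cong (λ t → ∥ y ∥ + t + ∥ v ⊖ y′ ∥) (∥unit∥ j s) ⟩
          ∥ y ∥ + 1 + ∥ v ⊖ y′ ∥                ≡⟨ ℕₚ.+-assoc ∥ y ∥ 1 _ ⟩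
          ∥ y ∥ + (suc ∥ v ⊖ y′ ∥)              ≡⟨ cong (λ t → ∥ y ∥ + t) shrink ⟩
          ∥ y ∥ + ∥ v ⊖ y ∥                     ≤⟨ tight ⟩
          ∥ v ∥                                 ∎

      first-step : ∀ j s → 0ℤ ℤ.< (s ◃ 1) ℤ.* v j →
                   suc ∥ v ⊖ (0⃗ ⊕ stepVec (j , s , 1F)) ∥ ≡ ∥ v ∥ ×
                   Trail (j , s , 1F) (0⃗ ⊕ stepVec (j , s , 1F)) (j , s , 1F)
      first-step j s positive with take-step {h = h} {0⃗} h tight₀ positive′ image₁
        where
        h = (j , s , 1F)
        v⊖0⃗≗v : v ⊖ 0⃗ ≗ v
        v⊖0⃗≗v k = ℤₚ.+-identityʳ (v k)
        tight₀ : ∥ 0⃗ {m} ∥ + ∥ v ⊖ 0⃗ ∥ ≤ ∥ v ∥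
        tight₀ = ℕₚ.≤-reflexive (cong₂ _+_ (x≗0⃗⇒∥x∥≡0 {m} {0⃗} (λ _ → refl)) (∥∥-cong v⊖0⃗≗v))
        positive′ : 0ℤ ℤ.< (s ◃ 1) ℤ.* (v ⊖ 0⃗) j
        positive′ = subst (λ z → 0ℤ ℤ.< (s ◃ 1) ℤ.* z) (sym (v⊖0⃗≗v j)) positive
        image₁ : image (0⃗ ⊕ stepVec h) ≗ boundary h h
        image₁ i = trans (image-cong (λ k → ℤₚ.+-identityˡ (stepVec h k)) i) (boundary-first j s i)
      ... | shrink , trail = trans shrink (∥∥-cong (λ k → ℤₚ.+-identityʳ (v k))) , trail

      no-dead-end : ∀ {h y u} → Trail h y u → ¬ v ⊖ y ≗ 0⃗ →
                    ¬ (∀ j → (opposite (sign u) ◃ 1) ℤ.* (+ toℕ (D (arrival u) j) ℤ.* (v ⊖ y) j) ℤ.≤ 0ℤ)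
      no-dead-end {h} {y} {u} t rest≢0 nonpositive = ℕₚ.<⇒≱ short (begin
        2 * lam            ≡⟨ cong (λ t → lam + t) (ℕₚ.+-identityʳ lam) ⟩
        lam + lam          ≤⟨ ℕₚ.+-mono-≤ (lam≤∥x∥ y∈L y≢0) (lam≤∥x∥ rest∈L rest≢0) ⟩
        ∥ y ∥ + ∥ v ⊖ y ∥  ≤⟨ ∥y∥+∥v⊖y∥≤∥v∥ t ⟩
        ∥ v ∥              ∎)
        where
        open ℕₚ.≤-Reasoning
        σ′ = opposite (sign u) ◃ 1
        a = arrival u
        rest-image : image (v ⊖ y) a ≡ 0ℤ ℤ.- boundary h u a
        rest-image = trans (image-⊖ v y a) (cong₂ ℤ._-_ (v∈L a) (image≗boundary t a))
        signed-sum : σ′ ℤ.* image (v ⊖ y) a ℤ.≤ 0ℤ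
        signed-sum = subst (ℤ._≤ 0ℤ) (sumℤ-*ˡ σ′ (λ j → + toℕ (D a j) ℤ.* (v ⊖ y) j))
                           (sumℤ-nonpositive nonpositive)
        closed : boundary h u ≗ 0⃗
        closed = boundary-closes h u (subst (λ z → σ′ ℤ.* z ℤ.≤ 0ℤ) rest-image signed-sum)
        y∈L : image y ≗ 0⃗
        y∈L i = trans (image≗boundary t i) (closed i)
        rest∈L : image (v ⊖ y) ≗ 0⃗
        rest∈L i = trans (image-⊖ v y i) (cong₂ ℤ._-_ (v∈L i) (y∈L i))
        y≢0 : ¬ y ≗ 0⃗
        y≢0 y≗0 = ℕₚ.<-irrefl (∥∥-cong v⊖y≗v) (∥v⊖y∥<∥v∥ t)
          where
          v⊖y≗v : v ⊖ y ≗ v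
          v⊖y≗v k = trans (cong (λ z → v k ℤ.- z) (y≗0 k)) (ℤₚ.+-identityʳ (v k))

      extend : ∀ {h y u} → Trail h y u → ¬ v ⊖ y ≗ 0⃗ →
               Σ (Step m) λ u′ → suc ∥ v ⊖ (y ⊕ stepVec u′) ∥ ≡ ∥ v ⊖ y ∥ × Trail h (y ⊕ stepVec u′) u′
      extend {h} {y} {u} t rest≢0
        with any? (λ j → ¬? (toℕ (D (arrival u) j) ℕₚ.≟ 0) ×-dec (0ℤ ℤₚ.<? (σ′ ◃ 1) ℤ.* (v ⊖ y) j))
        where σ′ = opposite (sign u)
      ... | yes (j , incident , positive) with other-end incident
      ...   | b , col = (j , opposite (sign u) , b) ,
                        take-step (j , opposite (sign u) , b) (∥y∥+∥v⊖y∥≤∥v∥ t) positive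
                                  (boundary-extend {h = h} {u} {y} {j} {b} col (image≗boundary t))
      extend {h} {y} {u} t rest≢0 | no none = contradiction termwise (no-dead-end t rest≢0)
        where
        termwise : ∀ j → (opposite (sign u) ◃ 1) ℤ.* (+ toℕ (D (arrival u) j) ℤ.* (v ⊖ y) j) ℤ.≤ 0ℤ
        termwise j = signed-term-nonpositive (toℕ (D (arrival u) j)) (opposite (sign u) ◃ 1) ((v ⊖ y) j)
                       (λ incident → ℤₚ.≮⇒≥ (λ positive → none (j , incident , positive)))

      walk : ∀ n {h y u} → ∥ v ⊖ y ∥ ≡ n → Trail h y u →
             Σ (List (Step m)) λ us → Walk h y v us × length us ≡ n
      walk zero {y = y} ∥v⊖y∥≡0 t =
        [] , done (λ k → sym (ℤₚ.i-j≡0⇒i≡j (v k) (y k) (∥x∥≡0⇒x≗0⃗ {x = v ⊖ y} ∥v⊖y∥≡0 k))) , refl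
      walk (suc n) ∥v⊖y∥≡1+n t
        with extend t (λ rest≗0 → ℕₚ.0≢1+n (trans (sym (x≗0⃗⇒∥x∥≡0 rest≗0)) ∥v⊖y∥≡1+n))
      ... | u′ , shrink , t′ with walk n (ℕₚ.suc-injective (trans shrink ∥v⊖y∥≡1+n)) t′
      ...   | us , w , len = u′ ∷ us , step (image≗boundary t′) w , cong suc len

      alternating-walk : ¬ v ≗ 0⃗ →
                         Σ (Step m) λ h → Σ (List (Step m)) λ us → Walk h 0⃗ v us × length us ≡ ∥ v ∥
      alternating-walk v≢0 with Finₚ.¬∀⟶∃¬ m _ (λ k → v k ℤₚ.≟ 0ℤ) v≢0
      ... | j , vj≢0 with sign-of (v j) vj≢0
      ...   | s , positive with first-step j s positive
      ...     | shrink , t with walk _ refl t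
      ...       | us , w , len =
        (j , s , 1F) , (j , s , 1F) ∷ us , step (image≗boundary t) w , trans (cong suc len) shrink

    Chunks-injective : ∀ {s h a a′ v w cs} → s + s < lam → a ≗ a′ →
                       Chunks s h a v cs → Chunks s h a′ w cs → v ≗ w
    Chunks-injective _ a≗a′ (done a≗v) (done a′≗w) k = trans (sym (a≗v k)) (trans (a≗a′ k) (a′≗w k))
    Chunks-injective {s} {a = a} {a′} s+s<lam a≗a′ (chunk {b = b} {c = c} small img rest)
                                               (chunk {b = b′} small′ img′ rest′) =
      Chunks-injective s+s<lam b≗b′ rest rest′
      where
      difference : ∀ x y y′ e → y ℤ.- y′ ≡ (y ℤ.- x ℤ.- e) ℤ.- (y′ ℤ.- x ℤ.- e)
      difference = solve-∀
      pointwise : ∀ k → ∣ (b ⊖ b′) k ∣ ≤ ∣ (b ⊖ a ⊖ stepVec c) k ∣ + ∣ (b′ ⊖ a′ ⊖ stepVec c) k ∣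
      pointwise k rewrite difference (a k) (b k) (b′ k) (stepVec c k) | a≗a′ k =
        ℤₚ.∣i-j∣≤∣i∣+∣j∣ ((b ⊖ a′ ⊖ stepVec c) k) ((b′ ⊖ a′ ⊖ stepVec c) k)
      b≗b′ : b ≗ b′
      b≗b′ = separated (λ i → trans (img i) (sym (img′ i))) (begin-strict
        ∥ b ⊖ b′ ∥
          ≤⟨ ∥∥-subadditive {x = b ⊖ b′} {b ⊖ a ⊖ stepVec c} {b′ ⊖ a′ ⊖ stepVec c} pointwise ⟩
        ∥ b ⊖ a ⊖ stepVec c ∥ + ∥ b′ ⊖ a′ ⊖ stepVec c ∥
          ≤⟨ ℕₚ.+-mono-≤ small small′ ⟩
        s + s
          <⟨ s+s<lam ⟩
        lam
          ∎)
        where open ℕₚ.≤-Reasoning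

    Encodes-injective : ∀ {s v w} code → s + s < lam → Encodes s v code → Encodes s w code → v ≗ w
    Encodes-injective []      _       v≗0 w≗0 k = trans (v≗0 k) (sym (w≗0 k))
    Encodes-injective (h ∷ _) s+s<lam v-chunks w-chunks =
      Chunks-injective s+s<lam (λ _ → refl) v-chunks w-chunks

    encode : ∀ s {v} → lam ≤ suc s + suc s → image v ≗ 0⃗ → ∥ v ∥ < 2 * lam →
             Σ (List (Step m)) λ code → Encodes s v code × length code ≤ 5
    encode s {v} lam≤ v∈L short with all? (λ k → v k ℤₚ.≟ 0ℤ)
    ... | yes v≗0 = [] , v≗0 , z≤n
    ... | no v≢0 with Walking.alternating-walk v∈L short v≢0
    ...   | h , us , w , len with regroup s 4 us walk-length w
      where
      double-sum : ∀ t → 2 * (t + t) ≡ 4 * t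
      double-sum = ℕ-solve-∀
      walk-length : length us ≤ 4 * suc s
      walk-length = begin
        length us            ≡⟨ len ⟩
        ∥ v ∥                ≤⟨ ℕₚ.<⇒≤ short ⟩
        2 * lam              ≤⟨ ℕₚ.*-monoʳ-≤ 2 lam≤ ⟩
        2 * (suc s + suc s)  ≡⟨ double-sum (suc s) ⟩
        4 * suc s            ∎
        where open ℕₚ.≤-Reasoning
    ...     | cs , chunks , len′ = h ∷ cs , chunks , s≤s len′

    ShortLatticeVector : Vec ℤ m → Set
    ShortLatticeVector v = InLattice D v × norm1 v < 2 * lam

    short-vectors-count : ∀ s → s + s < lam → lam ≤ suc s + suc s → ∀ {vs} → Unique vs →
                          All ShortLatticeVector vs → length vs ≤ suc (m * 4) ^ 5
    short-vectors-count s s+s<lam lam≤ unique short =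
      Unique⇒length≤ {P = ShortLatticeVector} unique short (λ {v} → index {v}) index-injective
      where
      code : ∀ {v} → ShortLatticeVector v →
             Σ (List (Step m)) λ code → Encodes s (lookup v) code × length code ≤ 5
      code {v} (v∈L , v-short) = encode s {lookup v} lam≤ v∈L v-short
      index : ∀ {v} → ShortLatticeVector v → Fin (suc (m * 4) ^ 5)
      index {v} pv = encodeList {n = 5} (map stepIndex (proj₁ (code {v} pv)))
      index-injective : ∀ {v w} (pv : ShortLatticeVector v) (pw : ShortLatticeVector w) →
                        index {v} pv ≡ index {w} pw → v ≡ w
      index-injective {v} {w} pv pw eq with code {v} pv | code {w} pw
      ... | c , v-code , len | c′ , w-code , len′
        with Listₚ.map-injective stepIndex-injective {c} {c′}
               (encodeList-injective (≤5 c len) (≤5 c′ len′) eq)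
        where
        ≤5 : ∀ c → length c ≤ 5 → length (map stepIndex c) ≤ 5
        ≤5 c = subst (_≤ 5) (sym (Listₚ.length-map stepIndex c))
      ... | refl = lookup-injective {v = v} {w} (Encodes-injective c s+s<lam v-code w-code)

  short-vectors-bound : ∀ lam → IsMinNorm D lam → ∀ {vs} → Unique vs →
                        All (λ v → InLattice D v × norm1 v < 2 * lam) vs → length vs ≤ suc (m * 4) ^ 5
  short-vectors-bound zero    _     {[]}    _      _               = z≤n
  short-vectors-bound zero    _     {_ ∷ _} _      ((_ , ()) ∷ _)
  short-vectors-bound (suc l) isMin         unique short with halve l
  ... | s , s+s≤l , l≤ = Minimal.short-vectors-count (suc l) isMin s (s≤s s+s≤l) (s≤s l≤) unique short

two≤m : ∀ {p m} (D : Matrix012 p m) → ColumnSumsTwo D → ∀ {lam} → IsMinNorm D lam → 2 ≤ m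
two≤m {m = zero}        _ _       ((Vec.[] , _ , v≢0 , _) , _)         = contradiction refl v≢0
two≤m {m = suc (suc m)} _ _       _                                     = s≤s (s≤s z≤n)
two≤m {m = suc zero}    D columns ((a Vec.∷ Vec.[] , v∈L , v≢0 , _) , _) =
  contradiction (cong (Vec._∷ Vec.[]) a≡0) v≢0
  where
  open Lattice D columns
  single : unit zero a ≗ lookup (a Vec.∷ Vec.[])
  single zero = refl
  unit∈L : image (unit zero a) ≗ 0⃗
  unit∈L i = trans (image-cong single i) (v∈L i)
  a≡0 : a ≡ 0ℤ
  a≡0 = image-unit≗0⃗⇒≡0 zero a unit∈L

lemma3p2 : ∃ λ (c : ℕ) → ∀ (p m : ℕ) (D : Matrix012 p m) → ColumnSumsTwo D
    → ∀ (lam : ℕ) → IsMinNorm D lam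
    → ∀ (vs : List (Vec ℤ m)) → Unique vs
    → All (λ v → InLattice D v × norm1 v < 2 * lam) vs
    → length vs ≤ m ^ c
lemma3p2 = 20 , λ p m D columns lam isMin vs unique short →
  ℕₚ.≤-trans (Lattice.short-vectors-bound D columns lam isMin unique short)
             (power-bound (two≤m D columns isMin))
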